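{- Let $V=\{1,\#_p,\#_c,0\}$ and consider the truth-relation $\models_{\{1,\#_p\},\{1,\#_c\}}$. For every $n$ and every pair $(\mathcal{B}^p,\mathcal{B}^c)$ of premise/conclusion regularity rules for an $n$-ary connective, there is a unique truth function $f:V^n\to V$ satisfying this regularity rule at the level of truth values, i.e. such that for all $\gamma,\delta\subseteq V$ and $x_1,\dots,x_n\in V$: $\gamma\cup\{f(\vec x)\}\models\delta$ iff for all $(B_p,B_c)\in\mathcal{B}^p$, $\gamma\cup\{x_i:i\in B_p\}\models\{x_i:i\in B_c\}\cup\delta$; and $\gamma\models\{f(\vec x)\}\cup\delta$ iff for all $(B_p,B_c)\in\mathcal{B}^c$, $\gamma\cup\{x_i:i\in B_p\}\models\{x_i:i\in B_c\}\cup\delta$.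
   Context: Here $\models_{\mathcal{D}_p,\mathcal{D}_c}$ denotes the relation on $\mathcal{P}(V)\times\mathcal{P}(V)$: $\gamma\models_{\mathcal{D}_p,\mathcal{D}_c}\delta$ iff ($\gamma\subseteq\mathcal{D}_p\Rightarrow\delta\cap\mathcal{D}_c\neq\emptyset$). A regularity rule for an $n$-ary connective is a pair $\mathcal{B}^p,\mathcal{B}^c\subseteq\mathcal{P}(\{1,\dots,n\})\times\mathcal{P}(\{1,\dots,n\})$. Empty conjunctions count as true. -}

module Defs where

open import Data.Bool.Base using (Bool; T)
open import Data.Fin.Subset using (Subset) renaming (_∈_ to _∈ˢ_)
open import Data.Nat.Base using (ℕ)
open import Data.Product using (∃; _×_)
open import Data.Vec.Base using (Vec; lookup)
open import Function.Bundles using (_⇔_)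
open import Level using (0ℓ; suc)
open import Relation.Binary.PropositionalEquality using (_≡_)
open import Relation.Unary using (Pred; _⊆_; _∩_; _∪_; ｛_｝; Satisfiable)

data V : Set where
  𝟙 #p #c 𝟘 : V

-- Constructively, "δ ∩ 𝒟c ≠ ∅" is read as inhabitedness.
TruthRelation : (𝒟p 𝒟c : Pred V 0ℓ) → Pred V 0ℓ → Pred V 0ℓ → Set
TruthRelation 𝒟p 𝒟c γ δ = γ ⊆ 𝒟p → Satisfiable (δ ∩ 𝒟c)

infix 4 _⊨_

_⊨_ : Pred V 0ℓ → Pred V 0ℓ → Set
_⊨_ = TruthRelation (｛ 𝟙 ｝ ∪ ｛ #p ｝) (｛ 𝟙 ｝ ∪ ｛ #c ｝)

-- A subset of the finite set 𝒫{1,…,n} × 𝒫{1,…,n}, given (like Subset itself)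
-- by its Boolean characteristic function.
Rule : ℕ → Set
Rule n = Subset n → Subset n → Bool

-- { xᵢ : i ∈ B }
values : ∀ {n} → Vec V n → Subset n → Pred V 0ℓ
values xs B v = ∃ λ i → i ∈ˢ B × v ≡ lookup xs i

Conditions : ∀ {n} → Rule n → Vec V n → Pred V 0ℓ → Pred V 0ℓ → Set
Conditions {n} 𝓑 xs γ δ = (Bp Bc : Subset n) → T (𝓑 Bp Bc) →
  γ ∪ values xs Bp ⊨ values xs Bc ∪ δ

Satisfies : ∀ {n} → (𝓑ᵖ 𝓑ᶜ : Rule n) → (Vec V n → V) → Set (suc 0ℓ)
Satisfies {n} 𝓑ᵖ 𝓑ᶜ f = (γ δ : Pred V 0ℓ) (xs : Vec V n) →
  (γ ∪ ｛ f xs ｝ ⊨ δ ⇔ Conditions 𝓑ᵖ xs γ δ) ×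
  (γ ⊨ ｛ f xs ｝ ∪ δ ⇔ Conditions 𝓑ᶜ xs γ δ)

{-# OPTIONS --safe #-}
-- For fixed truth values of the arguments, the conditions of a rule either hold
-- for all γ and δ, or some pair (Bp , Bc) makes them equivalent to γ ⊨ δ.  In
-- the same way, adding the premise v to γ ⊨ δ makes the entailment hold always
-- or changes nothing, according to whether v is outside {1, #p} or not, and
-- dually for a conclusion v and {1, #c}.  The two rules therefore prescribe
-- independently whether f(x) belongs to {1, #p} and to {1, #c}, and each of the
-- four combinations is realised by exactly one element of V.
module Submission where

open import Defs
open import Data.Bool.Base using (Bool; true; false; T)
open import Data.Bool.Properties using (T?)
open import Data.Fin.Properties using (all?; any?)
open import Data.Fin.Subset using (Subset)
open import Data.Fin.Subset.Properties using (anySubset?; _∈?_)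
open import Data.Nat.Base using (ℕ)
open import Data.Product using (∃₂; ∃!; _×_; _,_; proj₁; proj₂)
open import Data.Sum.Base using (inj₁; inj₂; [_,_]′)
open import Data.Vec.Base using (Vec; lookup)
open import Function.Base using (const)
open import Function.Bundles using (_⇔_; mk⇔; Equivalence)
open import Function.Construct.Composition using (_⇔-∘_)
open import Function.Construct.Symmetry using (⇔-sym)
open import Level using (0ℓ)
open import Relation.Binary.PropositionalEquality
  using (_≡_; refl; sym; trans; cong₂; _≗_)
open import Relation.Nullary using (¬_; Dec; yes; no; does; contradiction)
open import Relation.Nullary.Decidable
  using (_×-dec_; _→-dec_; ¬?; map′; does-⇔; decidable-stable)
open import Relation.Unary using (Pred; Decidable; ∅; _∈_; _∉_; _⊆_; _∩_; _∪_; ｛_｝; Satisfiable)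

open Equivalence using (to; from)

𝒟p 𝒟c : Pred V 0ℓ
𝒟p = ｛ 𝟙 ｝ ∪ ｛ #p ｝
𝒟c = ｛ 𝟙 ｝ ∪ ｛ #c ｝

_∈𝒟p? : Decidable 𝒟p
𝟙  ∈𝒟p? = yes (inj₁ refl)
#p ∈𝒟p? = yes (inj₂ refl)
#c ∈𝒟p? = no [ (λ ()) , (λ ()) ]′
𝟘  ∈𝒟p? = no [ (λ ()) , (λ ()) ]′

_∈𝒟c? : Decidable 𝒟c
𝟙  ∈𝒟c? = yes (inj₁ refl)
#p ∈𝒟c? = no [ (λ ()) , (λ ()) ]′
#c ∈𝒟c? = yes (inj₂ refl)
𝟘  ∈𝒟c? = no [ (λ ()) , (λ ()) ]′

-- The first Boolean records membership in the complement of 𝒟p.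
value : Bool → Bool → V
value false true  = 𝟙
value false false = #p
value true  true  = #c
value true  false = 𝟘

value-does : ∀ v → value (does (¬? (v ∈𝒟p?))) (does (v ∈𝒟c?)) ≡ v
value-does 𝟙  = refl
value-does #p = refl
value-does #c = refl
value-does 𝟘  = refl

module _ {P Q : Set} where

  value-∉𝒟p : (P? : Dec P) (Q? : Dec Q) → value (does P?) (does Q?) ∉ 𝒟p ⇔ P
  value-∉𝒟p (yes p) (yes _) = mk⇔ (const p) (const [ (λ ()) , (λ ()) ]′)
  value-∉𝒟p (yes p) (no _)  = mk⇔ (const p) (const [ (λ ()) , (λ ()) ]′)
  value-∉𝒟p (no ¬p) (yes _) = mk⇔ (contradiction (inj₁ refl)) (λ p → contradiction p ¬p)
  value-∉𝒟p (no ¬p) (no _)  = mk⇔ (contradiction (inj₂ refl)) (λ p → contradiction p ¬p)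

  value-∈𝒟c : (P? : Dec P) (Q? : Dec Q) → value (does P?) (does Q?) ∈ 𝒟c ⇔ Q
  value-∈𝒟c (no _)  (yes q) = mk⇔ (const q) (const (inj₁ refl))
  value-∈𝒟c (yes _) (yes q) = mk⇔ (const q) (const (inj₂ refl))
  value-∈𝒟c (no _)  (no ¬q) = mk⇔ [ (λ ()) , (λ ()) ]′ (λ q → contradiction q ¬q)
  value-∈𝒟c (yes _) (no ¬q) = mk⇔ [ (λ ()) , (λ ()) ]′ (λ q → contradiction q ¬q)

-- `value` rebuilds an element from its two membership bits, and equivalent decidable propositions
-- have equal bits.
≡-by-membership : ∀ {v w} → v ∉ 𝒟p ⇔ w ∉ 𝒟p → v ∈ 𝒟c ⇔ w ∈ 𝒟c → v ≡ w
≡-by-membership {v} {w} p c =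
  trans (sym (value-does v))
    (trans (cong₂ value (does-⇔ p (¬? (v ∈𝒟p?)) (¬? (w ∈𝒟p?)))
                        (does-⇔ c (v ∈𝒟c?) (w ∈𝒟c?)))
           (value-does w))

module _ {γ δ : Pred V 0ℓ} {v : V} where

  ∉𝒟p⇒premise-⊨ : v ∉ 𝒟p → γ ∪ ｛ v ｝ ⊨ δ
  ∉𝒟p⇒premise-⊨ v∉ γv⊆ = contradiction (γv⊆ (inj₂ refl)) v∉

  ∈𝒟p⇒premise-⇔ : v ∈ 𝒟p → γ ∪ ｛ v ｝ ⊨ δ ⇔ γ ⊨ δ
  ∈𝒟p⇒premise-⇔ v∈ = mk⇔ {A = γ ∪ ｛ v ｝ ⊨ δ} {B = γ ⊨ δ}
    (λ h γ⊆ → h λ { (inj₁ w∈γ) → γ⊆ w∈γ ; (inj₂ refl) → v∈ })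
    (λ h γv⊆ → h λ w∈γ → γv⊆ (inj₁ w∈γ))

  ∈𝒟c⇒conclusion-⊨ : v ∈ 𝒟c → γ ⊨ ｛ v ｝ ∪ δ
  ∈𝒟c⇒conclusion-⊨ v∈ _ = v , inj₁ refl , v∈

  ∉𝒟c⇒conclusion-⇔ : v ∉ 𝒟c → γ ⊨ ｛ v ｝ ∪ δ ⇔ γ ⊨ δ
  ∉𝒟c⇒conclusion-⇔ v∉ = mk⇔ {A = γ ⊨ ｛ v ｝ ∪ δ} {B = γ ⊨ δ}
    (λ h γ⊆ → case-∪ (h γ⊆))
    (λ h γ⊆ → let (w , w∈δ , w∈) = h γ⊆ in w , inj₂ w∈δ , w∈)
    where
    case-∪ : Satisfiable ((｛ v ｝ ∪ δ) ∩ 𝒟c) → Satisfiable (δ ∩ 𝒟c)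
    case-∪ (_ , inj₁ refl , w∈) = contradiction w∈ v∉
    case-∪ (w , inj₂ w∈δ  , w∈) = w , w∈δ , w∈

-- `∅ ⊨ ∅` is false, so with empty side sets the entailment can only hold because of `v`. This
-- instance is the test used for uniqueness.
premise-∅⇔ : ∀ {v} → ∅ ∪ ｛ v ｝ ⊨ ∅ ⇔ v ∉ 𝒟p
premise-∅⇔ = mk⇔
  (λ h v∈ → proj₁ (proj₂ (to (∈𝒟p⇒premise-⇔ v∈) h λ ())))
  ∉𝒟p⇒premise-⊨

conclusion-∅⇔ : ∀ {v} → ∅ ⊨ ｛ v ｝ ∪ ∅ ⇔ v ∈ 𝒟c
conclusion-∅⇔ {v} = mk⇔
  -- If `v` were outside `𝒟c`, then `h` would reduce to `∅ ⊨ ∅`; decidability turns this into a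
  -- positive membership.
  (λ h → decidable-stable (v ∈𝒟c?)
    (λ v∉ → proj₁ (proj₂ (to (∉𝒟c⇒conclusion-⇔ v∉) h λ ()))))
  ∈𝒟c⇒conclusion-⊨

module _ {n : ℕ} (xs : Vec V n) {P : Pred V 0ℓ} (P? : Decidable P) (B : Subset n) where

  values-⊆? : Dec (values xs B ⊆ P)
  values-⊆? = map′ (λ { h (i , i∈B , refl) → h i i∈B }) (λ h i i∈B → h (i , i∈B , refl))
    (all? λ i → (i ∈? B) →-dec P? (lookup xs i))

  values-∩? : Dec (Satisfiable (values xs B ∩ P))
  values-∩? = map′ (λ { (i , i∈B , p) → lookup xs i , (i , i∈B , refl) , p })
                   (λ { (_ , (i , i∈B , refl) , p) → i , i∈B , p })
    (any? λ i → (i ∈? B) ×-dec P? (lookup xs i))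

module _ {n : ℕ} (𝓑 : Rule n) (xs : Vec V n) where

  -- A counterexample to `Conditions 𝓑 xs ∅ ∅`. It mentions neither `γ` nor `δ`, and it is decidable
  -- because subsets and positions are finite in number.
  Refuted : Set
  Refuted = ∃₂ λ Bp Bc →
    T (𝓑 Bp Bc) × values xs Bp ⊆ 𝒟p × ¬ Satisfiable (values xs Bc ∩ 𝒟c)

  refuted? : Dec Refuted
  refuted? = anySubset? λ Bp → anySubset? λ Bc →
    T? (𝓑 Bp Bc) ×-dec values-⊆? xs _∈𝒟p? Bp ×-dec ¬? (values-∩? xs _∈𝒟c? Bc)

  module _ {γ δ : Pred V 0ℓ} where

    ¬refuted⇒conditions : ¬ Refuted → Conditions 𝓑 xs γ δ
    ¬refuted⇒conditions ¬r Bp Bc b γB⊆ =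
      let (w , w∈B , w∈) = decidable-stable (values-∩? xs _∈𝒟c? Bc)
                             (λ ¬s → ¬r (Bp , Bc , b , (λ w∈B → γB⊆ (inj₂ w∈B)) , ¬s))
      in w , inj₁ w∈B , w∈

    -- The refuting pair adds only premises inside `𝒟p` and conclusions outside `𝒟c`, so its
    -- condition already gives `γ ⊨ δ`. The converse is weakening, for every pair.
    refuted⇒conditions-⇔ : Refuted → Conditions 𝓑 xs γ δ ⇔ γ ⊨ δ
    refuted⇒conditions-⇔ (Bp , Bc , b , Bp⊆ , ¬s) = mk⇔ {A = Conditions 𝓑 xs γ δ} {B = γ ⊨ δ}
      (λ h γ⊆ → case-∪ (h Bp Bc b λ { (inj₁ w∈γ) → γ⊆ w∈γ ; (inj₂ w∈B) → Bp⊆ w∈B }))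
      (λ h _ _ _ γB⊆ → let (w , w∈δ , w∈) = h (λ w∈γ → γB⊆ (inj₁ w∈γ)) in w , inj₂ w∈δ , w∈)
      where
      case-∪ : Satisfiable ((values xs Bc ∪ δ) ∩ 𝒟c) → Satisfiable (δ ∩ 𝒟c)
      case-∪ (w , inj₁ w∈B , w∈) = contradiction (w , w∈B , w∈) ¬s
      case-∪ (w , inj₂ w∈δ , w∈) = w , w∈δ , w∈

    -- The hypothesis `e` makes both sides collapse alike: to `γ ⊨ δ` if the rule is refuted, to
    -- truth otherwise.
    premise-⇔-conditions : ∀ {v} → v ∉ 𝒟p ⇔ (¬ Refuted) →
      γ ∪ ｛ v ｝ ⊨ δ ⇔ Conditions 𝓑 xs γ δ
    premise-⇔-conditions {v} e with refuted?
    ... | yes r = ⇔-sym (refuted⇒conditions-⇔ r)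
                  ⇔-∘ ∈𝒟p⇒premise-⇔ (decidable-stable (v ∈𝒟p?) λ v∉ → to e v∉ r)
    ... | no ¬r = mk⇔ (const (¬refuted⇒conditions ¬r)) (const (∉𝒟p⇒premise-⊨ (from e ¬r)))

    conclusion-⇔-conditions : ∀ {v} → v ∈ 𝒟c ⇔ (¬ Refuted) →
      γ ⊨ ｛ v ｝ ∪ δ ⇔ Conditions 𝓑 xs γ δ
    conclusion-⇔-conditions e with refuted?
    ... | yes r = ⇔-sym (refuted⇒conditions-⇔ r) ⇔-∘ ∉𝒟c⇒conclusion-⇔ (λ v∈ → to e v∈ r)
    ... | no ¬r = mk⇔ (const (¬refuted⇒conditions ¬r)) (const (∈𝒟c⇒conclusion-⊨ (from e ¬r)))

satisfies-unique : ∀ {n} {𝓑ᵖ 𝓑ᶜ : Rule n} {f g} →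
  Satisfies 𝓑ᵖ 𝓑ᶜ f → Satisfies 𝓑ᵖ 𝓑ᶜ g → f ≗ g
satisfies-unique sf sg xs =
  -- At empty `γ` and `δ` the conditions are the same for `f` and `g`, and they fix both membership
  -- bits.
  let (fp , fc) = sf ∅ ∅ xs
      (gp , gc) = sg ∅ ∅ xs
  in ≡-by-membership
       ((premise-∅⇔ ⇔-∘ ⇔-sym gp) ⇔-∘ (fp ⇔-∘ ⇔-sym premise-∅⇔))
       ((conclusion-∅⇔ ⇔-∘ ⇔-sym gc) ⇔-∘ (fc ⇔-∘ ⇔-sym conclusion-∅⇔))

theorem3p22 : (n : ℕ) (𝓑ᵖ 𝓑ᶜ : Rule n) → ∃! _≗_ (Satisfies 𝓑ᵖ 𝓑ᶜ)
theorem3p22 n 𝓑ᵖ 𝓑ᶜ = f , f-satisfies , satisfies-unique f-satisfies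
  where
  f : Vec V n → V
  -- Non-refutation should put the result outside `𝒟p` but inside `𝒟c`; as the first bit of `value`
  -- records the complement, both arguments have the same form.
  f xs = value (does (¬? (refuted? 𝓑ᵖ xs))) (does (¬? (refuted? 𝓑ᶜ xs)))

  f-satisfies : Satisfies 𝓑ᵖ 𝓑ᶜ f
  f-satisfies γ δ xs =
    let P? = ¬? (refuted? 𝓑ᵖ xs)
        Q? = ¬? (refuted? 𝓑ᶜ xs)
    in premise-⇔-conditions 𝓑ᵖ xs (value-∉𝒟p P? Q?)
     , conclusion-⇔-conditions 𝓑ᶜ xs (value-∈𝒟c P? Q?)
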